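{- Let $X=F(2^{\mathbb{Z}^n})$ and let $\{\mathcal{R}_m\}_{m\ge1}$ be a sequence of marker regions for $X$ satisfying the orthogonality properties for distances $d_1<d_2<\cdots$ (where $d_{k+1}>Kd_k$ for all $k$, for a suitable constant $K=K(n)$), constructed by the layered procedure described in the context; that is, $\mathcal{R}_m=\mathcal{R}^m_1$ for a family of clopen partitions $\{\mathcal{R}^m_k\}_{1\le k\le m}$ as described there. Let $X_k=\partial\mathcal{R}_k=\bigcup\{\partial R: R\in\mathcal{R}_k\}$ and $X_k^\infty=\bigcup_{m=k}^\infty X_m$. Then the following hold. (1) $\bigcap_k X_k^\infty=\varnothing$, and for each $k$ the connected components of $X\setminus X_k^\infty$ are finite. (2) (strong orthogonality) There is a constant $\epsilon=\epsilon(n)>0$ and a function $\delta: X\times\mathbb{N}\times\mathbb{N}\to n=\{0,1,\dots,n-1\}$ such that $\delta(x,k,\ell)=0$ unless $x\in X_k^\infty$ and $\ell\le k$, and satisfying: if $k<k'$, $x\in X_k$, $x'\in X_{k'}$, then for any $\ell\le k$, if $\delta(x,k,\ell)=\delta(x',k',\ell)$, then $\rho(x,x')>\epsilon d_\ell$.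
   Context: Setting. $\mathbb{Z}^n$ acts on $2^{\mathbb{Z}^n}$ by $(g\cdot x)(h)=x(g+h)$, and $F(2^{\mathbb{Z}^n})=\{x: g\cdot x\ne x\text{ for all }g\ne 0\}$ is the free part. Its Schreier graph has edges $(x,s\cdot x)$ for $s\in\{\pm e_1,\dots,\pm e_n\}$; connectedness refers to this graph, and $\rho$ is the distance on orbits. For a subset $R$ of an orbit, $\partial R=\{x\in R: s\cdot x\notin R\text{ for some standard generator }s\}$. A rectangle is a set $Q\cdot y$ with $Q=\mathbb{Z}^n\cap\prod_i[a_i,b_i]$. A clopen partition of $X$ is a partition into finite subsets of orbits (regions) such that for each $g\in\mathbb{Z}^n$ the set of $x$ with $x$ and $g\cdot x$ in the same piece is relatively clopen in $X$. Regions that are finite unions of rectangles are also regarded as subsets of $\mathbb{R}^n$; distances between parallel faces are perpendicular distances. Orthogonality properties. For a constant $\epsilon_*>0$ depending only on $n$ the partitions $\mathcal{R}^m_k$ ($1\le k\le m$) satisfy: (a) $\mathcal{R}^m_k$ is a clopen partition of $X$, and each of its regions is a finite disjoint union of rectangles, from an auxiliary clopen rectangular partition $\tilde{\mathcal{R}}^m_k$, with side lengths between $\frac12 d_k$ and $d_k$; (b) any face of a region in $\mathcal{R}^m_k$ is at least $\epsilon_*d_k$ away from any parallel face of a nearby region in $\mathcal{R}^j_k$ for any $k\le j<m$; (c) any face $F$ of a region in $\mathcal{R}^m_k$ is at least $\epsilon_*d_k$ away from any parallel face $F'$ of a nearby region in $\mathcal{R}^m_k$ unless $\rho(F,F')\le1$.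 Construction. $\mathcal{R}^m_m$ is a clopen rectangular partition at scale $d_m$. Fix constants $\eta>0$ and $0<\epsilon_0<\epsilon_1<\dots<\epsilon_n<\frac13\eta$ depending only on $n$, with $\epsilon_j<\frac1{12}\epsilon_{j+1}$, and let $d_k'$ be given by $d_k=\epsilon_0d_k'$. Given $\mathcal{R}^m_{k+1}$, take a clopen partition of $X$ into rectangles with side lengths between $\frac12d_k'$ and $d_k'$ whose faces are at least $\eta d_k'$ from parallel faces of nearby regions in $\mathcal{R}^m_{k+1}$ and satisfy the analogues of (b),(c) with $\eta d_k'$ in place of $\epsilon_*d_k$. Say a rectangle has type $j$ if there are exactly $j$ standard unit vectors $e$ such that it meets a face, perpendicular to $e$, of some region of $\mathcal{R}^m_{k+1}$. For $j=n,n-1,\dots,1$ in turn, subdivide the current type-$j$ rectangles into rectangles with side lengths between $\frac23\epsilon_jd_k'$ and $\epsilon_jd_k'$, each of whose faces is at least $\frac14\epsilon_jd_k'$ from parallel faces of $\mathcal{R}^m_{k+1}$ regions, keeping the separation of faces of rectangles in the resulting partition from parallel faces of rectangles in the same partition (at distance $>1$) and in the corresponding level-$k$ partitions for $k\le j'<m$ at least a constant (depending only on $n$) times $d_k$. Assign each resulting rectangle, in a clopen way, to one of the regions of $\mathcal{R}^m_{k+1}$ it intersects, and replace each region $R\in\mathcal{R}^m_{k+1}$ by the union of the rectangles assigned to it; this gives $\mathcal{R}^m_k$. Finally the rectangles are further subdivided to have side lengths between $\frac12d_k$ and $d_k$, maintaining these separation properties; this gives $\tilde{\mathcal{R}}^m_k$.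 Set $\mathcal{R}_m=\mathcal{R}^m_1$. (With this construction each region of $\mathcal{R}_m$ is connected with connected boundary, in fact homeomorphic to the closed unit ball of $\mathbb{R}^n$.)
   Formalization: The distances d_k and d_k' and the constants (ε_*, η, ε_0,…,ε_n, and the separation and nearness constants), which the text allows to be real, are taken to be rational. -}

module Defs where

open import Data.Bool.Base using (Bool)
open import Data.Fin.Base using (Fin; zero; suc; toℕ; fromℕ; inject₁)
open import Data.Fin.Subset using (Subset; ∣_∣) renaming (_∈_ to _∈ₛ_)
open import Data.Integer.Base as ℤ using (ℤ; +_; 0ℤ; 1ℤ; _◃_)
import Data.Integer.Properties as ℤ
open import Data.List.Base using (List)
open import Data.List.Relation.Unary.All using (All)
open import Data.List.Relation.Unary.Any using (Any)
open import Data.Nat.Base as ℕ using (ℕ; zero; suc)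
open import Data.Product.Base using (∃-syntax; _×_)
open import Data.Rational.Base using (ℚ; 0ℚ; ½; _/_; _*_; _≤_; _<_)
open import Data.Sign.Base using (Sign)
open import Data.Sum.Base using (_⊎_)
open import Data.Vec.Base using (Vec; []; _∷_; zipWith; replicate; lookup; map; _[_]≔_)
open import Function.Bundles using (_⇔_)
open import Level using (0ℓ)
open import Relation.Binary.Core using (Rel; _⇒_)
open import Relation.Binary.PropositionalEquality using (_≡_; _≢_; _≗_; refl; sym; trans; cong; cong₂)
open import Relation.Binary.Structures using (IsEquivalence)
open import Relation.Nullary.Negation using (¬_)
open import Relation.Unary using (Pred; U; _∈_; _∉_; _⊆_; _≐_; ∁; Decidable)

private
  variable
    n : ℕ

ℤ^ : ℕ → Set
ℤ^ n = Vec ℤ n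

infixl 6 _⊕_
_⊕_ : ℤ^ n → ℤ^ n → ℤ^ n
_⊕_ = zipWith ℤ._+_

𝟎 : ℤ^ n
𝟎 = replicate _ 0ℤ

gen : Sign → Fin n → ℤ^ n
gen σ i = 𝟎 [ i ]≔ (σ ◃ 1)

shift : ℤ^ n → (ℤ^ n → Bool) → (ℤ^ n → Bool)
shift g x h = x (g ⊕ h)

record FreePart (n : ℕ) : Set where
  constructor _,_
  field
    config : ℤ^ n → Bool
    free   : ∀ g → g ≢ 𝟎 → ¬ (shift g config ≗ config)

open FreePart public

infix 4 _≈_
_≈_ : Rel (FreePart n) 0ℓ
x ≈ y = config x ≗ config y

private
  ⊖_ : ℤ^ n → ℤ^ n
  ⊖_ = map (ℤ.-_)

  cancel : (g h : ℤ^ n) → g ⊕ (⊖ g ⊕ h) ≡ h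
  cancel []      []      = refl
  cancel (a ∷ g) (b ∷ h) = cong₂ _∷_
    (trans (sym (ℤ.+-assoc a (ℤ.- a) b))
      (trans (cong (ℤ._+ b) (ℤ.+-inverseʳ a)) (ℤ.+-identityˡ b)))
    (cancel g h)

  cancel′ : (g f h : ℤ^ n) → g ⊕ (f ⊕ (⊖ g ⊕ h)) ≡ f ⊕ h
  cancel′ []      []      []      = refl
  cancel′ (a ∷ g) (c ∷ f) (b ∷ h) = cong₂ _∷_
    (trans (cong (ℤ._+_ a) (trans (ℤ.+-comm c _) (ℤ.+-assoc (ℤ.- a) b c)))
      (trans (sym (ℤ.+-assoc a (ℤ.- a) _))
        (trans (cong (ℤ._+ (b ℤ.+ c)) (ℤ.+-inverseʳ a))
          (trans (ℤ.+-identityˡ _) (ℤ.+-comm b c)))))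
    (cancel′ g f h)

infixr 7 _·_
_·_ : ℤ^ n → FreePart n → FreePart n
config (g · x) = shift g (config x)
free (g · x) f f≢𝟎 eq = free x f f≢𝟎 λ h →
  trans (cong (config x) (sym (cancel′ g f h)))
    (trans (eq (⊖ g ⊕ h)) (cong (config x) (cancel g h)))

-- The topology relative to 2^(ℤⁿ): a basic neighbourhood of x fixes the
-- values of x on a finite set of coordinates.

Open : Pred (Pred (FreePart n) 0ℓ) 0ℓ
Open {n} A = ∀ {x} → x ∈ A → ∃[ W ] (∀ {y} →
  All {A = ℤ^ n} (λ h → config x h ≡ config y h) W → y ∈ A)

-- Decidability is automatic classically; constructively it says that A and
-- its complement cover the space.

Clopen : Pred (Pred (FreePart n) 0ℓ) 0ℓ
Clopen A = Decidable A × Open A × Open (∁ A)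

Finite : Pred (Pred (FreePart n) 0ℓ) 0ℓ
Finite A = ∃[ L ] (∀ {x} → x ∈ A → Any (x ≈_) L)

-- L is the number of edges; all vertices lie in A.

data Walk {n} (A : Pred (FreePart n) 0ℓ) : ℕ → Rel (FreePart n) 0ℓ where
  stop : ∀ {x y} → x ∈ A → x ≈ y → Walk A 0 x y
  move : ∀ {L x y} → x ∈ A → ∀ σ i → Walk A L (gen σ i · x) y → Walk A (suc L) x y

-- Empty when x ∉ A.

Component : Pred (FreePart n) 0ℓ → FreePart n → Pred (FreePart n) 0ℓ
Component A x y = ∃[ L ] Walk A L x y

ι : ℤ → ℚ
ι z = z / 1

-- ρ≤ q x y and ρ> q x y express ρ(x,y) ≤ q and ρ(x,y) > q for the graph
-- distance ρ, with ρ = ∞ between different orbits.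

ρ≤ : ℚ → Rel (FreePart n) 0ℓ
ρ≤ q x y = ∃[ L ] (Walk U L x y × ι (+ L) ≤ q)

ρ> : ℚ → Rel (FreePart n) 0ℓ
ρ> q x y = ∀ L → Walk U L x y → q < ι (+ L)

∂ : Pred (FreePart n) 0ℓ → Pred (FreePart n) 0ℓ
∂ A x = x ∈ A × ∃[ σ ] ∃[ i ] gen σ i · x ∉ A

record ClopenPartition (n : ℕ) : Set₁ where
  infix 4 _∼_
  field
    _∼_           : Rel (FreePart n) 0ℓ
    isEquivalence : IsEquivalence _∼_
    reflexive     : _≈_ ⇒ _∼_
    sameOrbit     : ∀ {x y} → x ∼ y → ∃[ g ] g · x ≈ y
    finite        : ∀ x → Finite (x ∼_)
    clopen        : ∀ g → Clopen (λ x → x ∼ g · x)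

-- Regions are indexed by arbitrary representatives.

region : ClopenPartition n → FreePart n → Pred (FreePart n) 0ℓ
region P x y = ClopenPartition._∼_ P x y

_Refines_ : ClopenPartition n → ClopenPartition n → Set
P Refines Q = ∀ x → region P x ⊆ region Q x

-- The rectangle Q · y with Q = ℤⁿ ∩ ∏ᵢ [aᵢ , bᵢ]; its side lengths are taken
-- to be bᵢ - aᵢ.

box : ℤ^ n → ℤ^ n → FreePart n → Pred (FreePart n) 0ℓ
box a b y z = ∃[ g ]
  ((∀ i → lookup a i ℤ.≤ lookup g i × lookup g i ℤ.≤ lookup b i) × g · y ≈ z)

IsRectangle : ℚ → ℚ → Pred (FreePart n) 0ℓ → Set
IsRectangle lo hi A = ∃[ y ] ∃[ a ] ∃[ b ] (A ≐ box a b y ×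
  (∀ i → let side = ι (lookup b i ℤ.- lookup a i) in lo ≤ side × side ≤ hi))

RectanglePartition : ℚ → ℚ → ClopenPartition n → Set
RectanglePartition lo hi P = ∀ x → IsRectangle lo hi (region P x)

-- The points of A at which A is left in direction σ eᵢ.

side : Pred (FreePart n) 0ℓ → Sign → Fin n → Pred (FreePart n) 0ℓ
side A σ i x = x ∈ A × gen σ i · x ∉ A

-- The face of A, perpendicular to eᵢ, that contains x.  A connected subset
-- of side A σ i lies in one hyperplane perpendicular to eᵢ, since no two of
-- its points differ by ±eᵢ; so its components are the flat pieces of the
-- boundary of A with outward normal σ eᵢ.

face : Pred (FreePart n) 0ℓ → Sign → Fin n → FreePart n → Pred (FreePart n) 0ℓ
face A σ i = Component (side A σ i)

-- For F and F′ contained in hyperplanes perpendicular to eᵢ, at most one c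
-- satisfies PerpendicularDistance i F F′ c.

PerpendicularDistance : Fin n → (F F′ : Pred (FreePart n) 0ℓ) → ℚ → Set
PerpendicularDistance i F F′ c =
  ∃[ x ] ∃[ g ] (x ∈ F × g · x ∈ F′ × c ≡ ι (+ ℤ.∣ lookup g i ∣))

Nearby : ℚ → (F F′ : Pred (FreePart n) 0ℓ) → Set
Nearby r F F′ = ∃[ x ] ∃[ y ] (x ∈ F × y ∈ F′ × ρ≤ r x y)

ForNearbyFaces : ℚ → (A B : Pred (FreePart n) 0ℓ) → Pred ℚ 0ℓ → Set
ForNearbyFaces r A B Φ = ∀ i σ τ x y →
  let F = face A σ i x ; F′ = face B τ i y in
  Nearby r F F′ → ∀ {c} → PerpendicularDistance i F F′ c → Φ c

-- Distances between parallel faces are perpendicular ones.  They are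
-- constrained for faces that come within r of each other: regions may be far
-- larger than the scale at which their faces are to be separated, and faces
-- in remote parts of two regions cannot be expected to avoid each other's
-- hyperplanes.

FacesApart : ℚ → ℚ → (A B : Pred (FreePart n) 0ℓ) → Set
FacesApart r s A B = ForNearbyFaces r A B (λ c → s ≤ c)

-- As above, up to coplanar or abutting faces.

FacesApart₁ : ℚ → ℚ → (A B : Pred (FreePart n) 0ℓ) → Set
FacesApart₁ r s A B = ForNearbyFaces r A B (λ c → c ≤ ι 1ℤ ⊎ s ≤ c)

Apart : ℚ → ℚ → (P Q : ClopenPartition n) → Set
Apart r s P Q = ∀ x y → FacesApart r s (region P x) (region Q y)

SelfApart : ℚ → ℚ → ClopenPartition n → Set
SelfApart r s P = ∀ x y → FacesApart₁ r s (region P x) (region P y)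

-- Constants depending only on n.  Faces are nearby at scale q when they come
-- within ν q of each other; sep is the constant in the separation of the
-- faces of the subdivided rectangles.

record Constants (n : ℕ) : Set where
  field
    ε⋆ η ν sep : ℚ
    ε          : Fin (suc n) → ℚ
    ε⋆-pos     : 0ℚ < ε⋆
    η-pos      : 0ℚ < η
    ν-pos      : 0ℚ < ν
    sep-pos    : 0ℚ < sep
    ε₀-pos     : 0ℚ < ε zero
    ε-mono     : ∀ j → ε (inject₁ j) < ε (suc j)
    ε-step     : ∀ j → ε (inject₁ j) < (+ 1 / 12) * ε (suc j)
    εₙ<η/3     : ε (fromℕ n) < (+ 1 / 3) * η

-- R m k is used for 1 ≤ k ≤ m only.

Family : ℕ → Set₁
Family n = ℕ → ℕ → ClopenPartition n

-- A refinement of R m k by R̃ m k makes every region of R m k a disjoint union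
-- of rectangles, finite since the region is.

record Orthogonal (C : Constants n) (d : ℕ → ℚ) (R R̃ : Family n) : Set where
  open Constants C
  field
    rectangles : ∀ {m k} → 1 ℕ.≤ k → k ℕ.≤ m →
      RectanglePartition (½ * d k) (d k) (R̃ m k) × (R̃ m k) Refines (R m k)
    apart      : ∀ {m k j} → 1 ℕ.≤ k → k ℕ.≤ j → j ℕ.< m →
      Apart (ν * d k) (ε⋆ * d k) (R m k) (R j k)
    selfApart  : ∀ {m k} → 1 ℕ.≤ k → k ℕ.≤ m →
      SelfApart (ν * d k) (ε⋆ * d k) (R m k)

MeetsFace : ClopenPartition n → Pred (FreePart n) 0ℓ → Fin n → Set
MeetsFace P A i = ∃[ w ] ∃[ σ ] ∃[ x ] ∃[ z ] (z ∈ A × z ∈ face (region P w) σ i x)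

HasType : ClopenPartition n → Pred (FreePart n) 0ℓ → ℕ → Set
HasType {n} P A j = ∃[ S ]
  (∣ S ∣ ≡ j × (∀ (i : Fin n) → (i ∈ₛ S) ⇔ MeetsFace P A i))

-- P′ arises from P by subdividing the rectangles of type j relative to R⁺
-- into rectangles of scale s.

record Subdivides (r s : ℚ) (R⁺ : ClopenPartition n) (j : ℕ)
                  (P P′ : ClopenPartition n) : Set where
  field
    refines  : P′ Refines P
    type≡j   : ∀ x → HasType R⁺ (region P x) j →
      IsRectangle ((+ 2 / 3) * s) s (region P′ x) ×
      (∀ y → FacesApart r ((+ 1 / 4) * s) (region P′ x) (region R⁺ y))
    type≢j   : ∀ x → ¬ HasType R⁺ (region P x) j → region P′ x ≐ region P x

-- Assigned x y: the rectangle of x in P is assigned to the region of y in R⁺.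

record Assignment (P R⁺ : ClopenPartition n) : Set₁ where
  open ClopenPartition P using () renaming (_∼_ to _∼ᴾ_)
  open ClopenPartition R⁺ using () renaming (_∼_ to _∼ᴿ_)
  field
    Assigned : Rel (FreePart n) 0ℓ
    respects : ∀ {x x′ y y′} → x ∼ᴾ x′ → y ∼ᴿ y′ → Assigned x y → Assigned x′ y′
    meets    : ∀ x → ∃[ y ] (x ∼ᴾ y × Assigned x y)
    unique   : ∀ {x y y′} → Assigned x y → Assigned x y′ → y ∼ᴿ y′
    clopen   : ∀ g → Clopen (λ x → Assigned x (g · x))

-- The passage from R m (k+1) to R m k.  Here layer (n) is the initial
-- partition into rectangles, and layer (j-1) arises from layer (j) by
-- subdividing the rectangles of type j, for j = n, …, 1.

record Layering (C : Constants n) (dₖ d′ₖ : ℚ) (R R̃ : Family n)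
                (m k : ℕ) : Set₁ where
  open Constants C
  R⁺ : ClopenPartition n
  R⁺ = R m (suc k)

  -- Separation, by a constant times dₖ, of the faces of the rectangles in P
  -- from each other and from the level-k partitions constructed earlier.
  Separated : ClopenPartition n → Set
  Separated P = SelfApart (ν * dₖ) (sep * dₖ) P ×
    (∀ {j} → k ℕ.≤ j → j ℕ.< m → Apart (ν * dₖ) (sep * dₖ) P (R j k))

  field
    layer : Fin (suc n) → ClopenPartition n

  base : ClopenPartition n
  base = layer (fromℕ n)

  field
    base-rectangles : RectanglePartition (½ * d′ₖ) d′ₖ base
    base-apart⁺     : Apart (ν * d′ₖ) (η * d′ₖ) base R⁺
    -- j = k is left out: the faces of R k k are at most dₖ = ε₀ d′ₖ < η d′ₖ
    -- apart, so nothing is η d′ₖ away from them; see Separated for j = k.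
    base-apart      : ∀ {j} → k ℕ.< j → j ℕ.< m →
      Apart (ν * d′ₖ) (η * d′ₖ) base (R j k)
    base-selfApart  : SelfApart (ν * d′ₖ) (η * d′ₖ) base

    subdivides : ∀ (j : Fin n) →
      Subdivides (ν * d′ₖ) (ε (suc j) * d′ₖ) R⁺ (suc (toℕ j))
                 (layer (suc j)) (layer (inject₁ j))
    separated  : ∀ (j : Fin n) → Separated (layer (inject₁ j))

    assignment : Assignment (layer zero) R⁺

  open Assignment assignment public using (Assigned)

  field
    regions : ∀ x x′ → region (R m k) x x′ ⇔ (∃[ y ] (Assigned x y × Assigned x′ y))

    final-refines   : (R̃ m k) Refines (layer zero)
    final-separated : Separated (R̃ m k)

record LayeredMarkers (C : Constants n) (d : ℕ → ℚ) (R : Family n) : Set₁ where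
  open Constants C
  field
    R̃          : Family n
    orthogonal : Orthogonal C d R R̃
    top        : ∀ {m} → 1 ℕ.≤ m → RectanglePartition (½ * d m) (d m) (R m m)
    d′         : ℕ → ℚ
    d≡ε₀d′     : ∀ {k} → 1 ℕ.≤ k → d k ≡ ε zero * d′ k
    layering   : ∀ {m k} → 1 ℕ.≤ k → k ℕ.< m → Layering C (d k) (d′ k) R R̃ m k

-- The final k-th partition is R k 1.

X : Family n → ℕ → Pred (FreePart n) 0ℓ
X R k x = ∃[ y ] x ∈ ∂ (region (R k 1) y)

X∞ : Family n → ℕ → Pred (FreePart n) 0ℓ
X∞ R k x = ∃[ m ] (k ℕ.≤ m × x ∈ X R m)

{-# OPTIONS --safe #-}
module Submission where

-- The separation of the regions of R k 1 is inherited from every level ℓ ≤ k.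
-- Suppose x ∈ X_k.  Neighbouring points in different regions of R k j lie in
-- rectangles assigned to different regions of R k (j+1), so a face of R k (j+1)
-- is within a constant times d_j.  As the d_j grow fast, summing over j < ℓ
-- puts x within τ d_ℓ of a face of R k ℓ, for a τ as small as we please;
-- δ(x,k,ℓ) is the least direction of such a face.  If x ∈ X_k and x′ ∈ X_k′,
-- k < k′, have the same δ, then two parallel faces of R k ℓ and R k′ ℓ would
-- violate orthogonality unless ρ(x,x′) > τ d_ℓ.
--
-- As δ takes n values, no point lies in X_k for n + 1 different k.  A walk that
-- avoids X_k never leaves its region of R k 1, whence the components are finite.

open import Defs
open import Algebra.Definitions using (Associative; Commutative)
open import Data.Bool.Base using (if_then_else_)
open import Data.Fin.Base using (Fin; zero; suc; toℕ; inject₁; fromℕ)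
import Data.Fin.Properties as Fin
open import Data.Integer.Base as ℤ using (+_; -[1+_]; 0ℤ; 1ℤ)
import Data.Integer.Properties as ℤ
open import Data.Nat.Base as ℕ using (ℕ; zero; suc; NonZero)
import Data.Nat.Properties as ℕ
open import Data.Product.Base using (∃-syntax; Σ-syntax; _×_; _,_; proj₁; proj₂)
open import Data.Rational.Base as ℚ using (ℚ; mkℚ; 0ℚ; _/_; _*_; _<_)
import Data.Rational.Properties as ℚ
open import Data.Rational.Solver using (module +-*-Solver)
open import Data.Rational.Unnormalised.Base as ℚᵘ using (mkℚᵘ)
import Data.Rational.Unnormalised.Properties as ℚᵘ
open import Data.Sign.Base as Sign using (Sign)
open import Data.Sum.Base using (_⊎_; inj₁; inj₂)
open import Data.Unit.Base using (tt)
open import Data.Vec.Base using ([]; _∷_; lookup; map)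
import Data.Vec.Properties as Vec
open import Function.Base using (_∘_; id)
open import Function.Bundles using (_⇔_; mk⇔; Equivalence)
open import Level using (0ℓ)
open import Relation.Binary.PropositionalEquality
  using (_≡_; refl; sym; trans; cong; cong₂; subst; subst₂; module ≡-Reasoning)
open import Relation.Binary.Structures using (IsEquivalence)
open import Relation.Nullary.Decidable
  using (Dec; yes; no; does; map′; ¬?; _×-dec_; _⊎-dec_; does-⇔; decidable-stable)
open import Relation.Nullary.Negation using (¬_; contradiction)
open import Relation.Unary using (Pred; _∈_; _∉_; _⊆_; ∁; U; Empty; ⋂; Decidable)

private
  variable
    n L M : ℕ

-- The action of ℤⁿ and its generators.

⊕-assoc : Associative _≡_ (_⊕_ {n})
⊕-assoc = Vec.zipWith-assoc ℤ.+-assoc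

⊕-comm : Commutative _≡_ (_⊕_ {n})
⊕-comm = Vec.zipWith-comm ℤ.+-comm

⊕-identityˡ : (g : ℤ^ n) → 𝟎 ⊕ g ≡ g
⊕-identityˡ = Vec.zipWith-identityˡ ℤ.+-identityˡ

infix 8 ⊝_
⊝_ : ℤ^ n → ℤ^ n
⊝_ = map (ℤ.-_)

⊝-inverseˡ : (g : ℤ^ n) → ⊝ g ⊕ g ≡ 𝟎
⊝-inverseˡ = Vec.zipWith-inverseˡ ℤ.+-inverseˡ

·-cong : ∀ (g : ℤ^ n) {x y} → x ≈ y → g · x ≈ g · y
·-cong g x≈y h = x≈y (g ⊕ h)

·-congˡ : ∀ {g h : ℤ^ n} x → g ≡ h → g · x ≈ h · x
·-congˡ x g≡h k = cong (λ f → config x (f ⊕ k)) g≡h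

·-assoc : ∀ (g h : ℤ^ n) x → g · h · x ≈ (g ⊕ h) · x
·-assoc g h x k = cong (config x)
  (trans (sym (⊕-assoc h g k)) (cong (_⊕ k) (⊕-comm h g)))

𝟎·_ : ∀ (x : FreePart n) → 𝟎 · x ≈ x
(𝟎· x) k = cong (config x) (⊕-identityˡ k)

⊝·-inverse : ∀ (g : ℤ^ n) x → ⊝ g · g · x ≈ x
⊝·-inverse g x k = trans (·-assoc (⊝ g) g x k)
  (trans (·-congˡ x (⊝-inverseˡ g) k) ((𝟎· x) k))

gen-opposite : ∀ σ (i : Fin n) → ⊝ gen σ i ≡ gen (Sign.opposite σ) i
gen-opposite Sign.- zero    = cong (_ ∷_) (Vec.map-replicate _ _ _)
gen-opposite Sign.+ zero    = cong (_ ∷_) (Vec.map-replicate _ _ _)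
gen-opposite σ      (suc i) = cong (_ ∷_) (gen-opposite σ i)

gen-bound : ∀ σ (i j : Fin n) → ℤ.∣ lookup (gen σ i) j ∣ ℕ.≤ 1
gen-bound Sign.- zero    zero    = ℕ.≤-refl
gen-bound Sign.+ zero    zero    = ℕ.≤-refl
gen-bound σ      zero    (suc j) rewrite Vec.lookup-replicate j 0ℤ = ℕ.z≤n
gen-bound σ      (suc i) zero    = ℕ.z≤n
gen-bound σ      (suc i) (suc j) = gen-bound σ i j

-- The ℓ¹ norm and walks in the Schreier graph.

‖_‖ : ℤ^ n → ℕ
‖ []    ‖ = 0
‖ a ∷ g ‖ = ℤ.∣ a ∣ ℕ.+ ‖ g ‖

-- One unit is taken off the first non-zero coordinate, towards zero. This drives the recursion in
-- `walkAlong`.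
unit-step : (g : ℤ^ n) → g ≡ 𝟎 × ‖ g ‖ ≡ 0 ⊎
  ∃[ σ ] ∃[ i ] ∃[ h ] (h ⊕ gen σ i ≡ g × suc ‖ h ‖ ≡ ‖ g ‖)
unit-step [] = inj₁ (refl , refl)
unit-step (+ zero ∷ g) with unit-step g
... | inj₁ (g≡𝟎 , eq)             = inj₁ (cong (0ℤ ∷_) g≡𝟎 , eq)
... | inj₂ (σ , i , h , eq , eq′) = inj₂ (σ , suc i , 0ℤ ∷ h , cong (0ℤ ∷_) eq , eq′)
unit-step (+ suc a ∷ g) = inj₂ (Sign.+ , zero , + a ∷ g ,
  cong₂ _∷_ (cong +_ (ℕ.+-comm a 1)) (trans (⊕-comm g 𝟎) (⊕-identityˡ g)) , refl)
unit-step (-[1+ a ] ∷ g) = inj₂ (Sign.- , zero , ℤ.- + a ∷ g ,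
  cong₂ _∷_ (eq a) (trans (⊕-comm g 𝟎) (⊕-identityˡ g)) ,
  cong (λ b → suc (b ℕ.+ ‖ g ‖)) (ℤ.∣-i∣≡∣i∣ (+ a)))
  where
  eq : ∀ a → ℤ.- + a ℤ.+ -[1+ 0 ] ≡ -[1+ a ]
  eq zero    = refl
  eq (suc a) = cong (λ b → -[1+ suc b ]) (ℕ.+-identityʳ a)

walk-respˡ : ∀ {x x′ y : FreePart n} → x ≈ x′ → Walk U L x y → Walk U L x′ y
walk-respˡ x≈x′ (stop _ x≈y) = stop tt λ k → trans (sym (x≈x′ k)) (x≈y k)
walk-respˡ {x = x} {x′} x≈x′ (move _ σ i w) =
  move tt σ i (walk-respˡ (·-cong (gen σ i) {x} {x′} x≈x′) w)

_++ʷ_ : ∀ {x y z : FreePart n} → Walk U L x y → Walk U M y z → Walk U (L ℕ.+ M) x z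
stop _ x≈y ++ʷ w = walk-respˡ (λ k → sym (x≈y k)) w
move _ σ i v ++ʷ w = move tt σ i (v ++ʷ w)

reverse : ∀ {x y : FreePart n} → Walk U L x y → Walk U L y x
reverse (stop _ x≈y) = stop tt λ k → sym (x≈y k)
reverse {L = suc L} {x = x} {y} (move _ σ i w) = subst (λ M → Walk U M y x) (ℕ.+-comm L 1)
  (reverse w ++ʷ move tt (Sign.opposite σ) i (stop tt back))
  where
  back : gen (Sign.opposite σ) i · gen σ i · x ≈ x
  back = subst (λ g → g · gen σ i · x ≈ x) (gen-opposite σ i) (⊝·-inverse (gen σ i) x)

-- Each edge changes a single coordinate, by one. This turns bounds on graph distance into bounds on
-- perpendicular distance between faces.
displacement : ∀ {x y : FreePart n} → Walk U L x y →
  ∃[ g ] (g · x ≈ y × ∀ i → ℤ.∣ lookup g i ∣ ℕ.≤ L)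
displacement {x = x} (stop _ x≈y) =
  𝟎 , (λ k → trans ((𝟎· x) k) (x≈y k)) ,
  λ i → subst (λ a → ℤ.∣ a ∣ ℕ.≤ 0) (sym (Vec.lookup-replicate i 0ℤ)) ℕ.z≤n
displacement {L = suc L} {x = x} (move _ σ i w) with displacement w
... | g , eq , bound = g ⊕ gen σ i ,
  (λ k → trans (sym (·-assoc g (gen σ i) x k)) (eq k)) ,
  λ j → subst (λ a → ℤ.∣ a ∣ ℕ.≤ suc L) (sym (Vec.lookup-zipWith ℤ._+_ j g (gen σ i)))
    (ℕ.≤-trans (ℤ.∣i+j∣≤∣i∣+∣j∣ (lookup g j) (lookup (gen σ i) j))
      (ℕ.≤-trans (ℕ.+-mono-≤ (bound j) (gen-bound σ i j)) (ℕ.≤-reflexive (ℕ.+-comm L 1))))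

walkAlong : ∀ (g : ℤ^ n) {x y} → g · x ≈ y → Walk U ‖ g ‖ x y
walkAlong g = go ‖ g ‖ g refl
  where
  -- The recursion is on the norm `L`, since the `h` given by `unit-step` is not a subterm of `g`.
  go : ∀ L (g : ℤ^ n) → ‖ g ‖ ≡ L → ∀ {x y} → g · x ≈ y → Walk U L x y
  go L g eq gx≈y with unit-step g
  go zero g eq {x} gx≈y | inj₁ (refl , _) =
    stop tt λ k → trans (sym ((𝟎· x) k)) (gx≈y k)
  go (suc L) g eq gx≈y | inj₁ (_ , ‖g‖≡0) = contradiction (trans (sym eq) ‖g‖≡0) λ ()
  go zero g eq gx≈y | inj₂ (_ , _ , _ , _ , eq′) = contradiction (trans eq′ eq) λ ()
  go (suc L) g eq {x} gx≈y | inj₂ (σ , i , h , refl , eq′) =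
    move tt σ i (go L h (ℕ.suc-injective (trans eq′ eq))
      λ k → trans (·-assoc h (gen σ i) x k) (gx≈y k))

-- Integers among the rationals.

ι≃ : ∀ z → ℚ.toℚᵘ (ι z) ℚᵘ.≃ mkℚᵘ z 0
ι≃ z = ℚ.toℚᵘ-fromℚᵘ (mkℚᵘ z 0)

ι-+ : ∀ a b → ι (a ℤ.+ b) ≡ ι a ℚ.+ ι b
ι-+ a b = ℚ.toℚᵘ-injective (ℚᵘ.≃-trans (ι≃ (a ℤ.+ b)) (ℚᵘ.≃-trans
  (ℚᵘ.≃-reflexive (cong (λ z → mkℚᵘ z 0) (cong₂ ℤ._+_ (sym (ℤ.*-identityʳ a)) (sym (ℤ.*-identityʳ b)))))
  (ℚᵘ.≃-sym (ℚᵘ.≃-trans (ℚ.toℚᵘ-homo-+ (ι a) (ι b)) (ℚᵘ.+-cong (ι≃ a) (ι≃ b))))))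

ι-mono : ∀ {a b} → a ℤ.≤ b → ι a ℚ.≤ ι b
ι-mono {a} {b} a≤b = ℚ.toℚᵘ-cancel-≤
  (ℚᵘ.≤-respˡ-≃ (ℚᵘ.≃-sym (ι≃ a)) (ℚᵘ.≤-respʳ-≃ (ℚᵘ.≃-sym (ι≃ b))
    (ℚᵘ.*≤* (ℤ.*-monoʳ-≤-nonNeg 1ℤ a≤b))))

ι-pos⇒1≤ : ∀ {a} → 0ℚ < ι a → ι 1ℤ ℚ.≤ ι a
ι-pos⇒1≤ {a} 0<a with a ℤ.≤? 0ℤ
... | yes a≤0 = contradiction (ℚ.<-≤-trans 0<a (ι-mono a≤0)) (ℚ.<-irrefl refl)
... | no  a≰0 = ι-mono (ℤ.i<j⇒suc[i]≤j (ℤ.≰⇒> a≰0))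

-- The denominator is at least 1, so the numerator is a crude bound. It makes the search in
-- `within?` finite.
ι≤⇒≤∣↥∣ : ∀ {L q} → ι (+ L) ℚ.≤ q → L ℕ.≤ ℤ.∣ ℚ.↥ q ∣
ι≤⇒≤∣↥∣ {L} {q} ι≤q
  with ℚᵘ.≤-respˡ-≃ (ι≃ (+ L)) (ℚ.toℚᵘ-mono-≤ ι≤q)
ι≤⇒≤∣↥∣ {L} {mkℚ (+ a) d _} ι≤q | ℚᵘ.*≤* le = ℕ.≤-trans (ℕ.m≤m*n L (suc d))
  (ℤ.drop‿+≤+ (subst₂ ℤ._≤_ (sym (ℤ.pos-* L (suc d))) (ℤ.*-identityʳ (+ a)) le))
ι≤⇒≤∣↥∣ {L} {mkℚ -[1+ a ] d _} ι≤q | ℚᵘ.*≤* le =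
  contradiction (subst (ℤ._≤ _) (sym (ℤ.pos-* L (suc d))) le) λ ()

-- Distance estimates and diameters of rectangles.

ρ≤-refl : ∀ {q} (x : FreePart n) → 0ℚ ℚ.≤ q → ρ≤ q x x
ρ≤-refl x 0≤q = 0 , stop tt (λ _ → refl) , 0≤q

ρ≤-sym : ∀ {q} {x y : FreePart n} → ρ≤ q x y → ρ≤ q y x
ρ≤-sym (L , w , L≤q) = L , reverse w , L≤q

ρ≤-trans : ∀ {p q} {x y z : FreePart n} → ρ≤ p x y → ρ≤ q y z → ρ≤ (p ℚ.+ q) x z
ρ≤-trans (L , v , L≤p) (M , w , M≤q) =
  L ℕ.+ M , v ++ʷ w , ℚ.≤-trans (ℚ.≤-reflexive (ι-+ (+ L) (+ M))) (ℚ.+-mono-≤ L≤p M≤q)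

ρ≤-mono : ∀ {p q} {x y : FreePart n} → p ℚ.≤ q → ρ≤ p x y → ρ≤ q x y
ρ≤-mono p≤q (L , w , L≤p) = L , w , ℚ.≤-trans L≤p p≤q

ρ≤-gen : ∀ σ i (x : FreePart n) → ρ≤ (ι 1ℤ) x (gen σ i · x)
ρ≤-gen σ i x = 1 , move tt σ i (stop tt (λ _ → refl)) , ℚ.≤-refl

‖‖-bound : ∀ {q} (g : ℤ^ n) → (∀ i → ι (+ ℤ.∣ lookup g i ∣) ℚ.≤ q) →
  ι (+ ‖ g ‖) ℚ.≤ ι (+ n) * q
‖‖-bound {q = q} [] _ = ℚ.≤-reflexive (sym (ℚ.*-zeroˡ q))
‖‖-bound {n = suc n} {q} (a ∷ g) bound = begin
  ι (+ (ℤ.∣ a ∣ ℕ.+ ‖ g ‖))       ≡⟨ ι-+ (+ ℤ.∣ a ∣) (+ ‖ g ‖) ⟩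
  ι (+ ℤ.∣ a ∣) ℚ.+ ι (+ ‖ g ‖)   ≤⟨ ℚ.+-mono-≤ (bound zero) (‖‖-bound g (bound ∘ suc)) ⟩
  q ℚ.+ ι (+ n) * q               ≡⟨ cong (ℚ._+ ι (+ n) * q) (ℚ.*-identityˡ q) ⟨
  ℚ.1ℚ * q ℚ.+ ι (+ n) * q        ≡⟨ ℚ.*-distribʳ-+ q ℚ.1ℚ (ι (+ n)) ⟨
  (ℚ.1ℚ ℚ.+ ι (+ n)) * q          ≡⟨ cong (_* q) (ι-+ 1ℤ (+ n)) ⟨
  ι (+ suc n) * q                 ∎
  where open ℚ.≤-Reasoning

interval-diameter : ∀ {a b i j} → a ℤ.≤ i × i ℤ.≤ b → a ℤ.≤ j × j ℤ.≤ b →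
  + ℤ.∣ i ℤ.- j ∣ ℤ.≤ b ℤ.- a
interval-diameter {a} {b} {i} {j} (a≤i , i≤b) (a≤j , j≤b) with ℤ.≤-total j i
... | inj₁ j≤i = ℤ.≤-trans (ℤ.≤-reflexive (ℤ.0≤i⇒+∣i∣≡i (ℤ.i≤j⇒0≤j-i j≤i)))
                   (ℤ.+-mono-≤ i≤b (ℤ.neg-mono-≤ a≤j))
... | inj₂ i≤j rewrite ℤ.∣i-j∣≡∣j-i∣ i j =
  ℤ.≤-trans (ℤ.≤-reflexive (ℤ.0≤i⇒+∣i∣≡i (ℤ.i≤j⇒0≤j-i i≤j)))
    (ℤ.+-mono-≤ j≤b (ℤ.neg-mono-≤ a≤i))

-- The box coordinates `g` and `h` of the two points differ by at most `hi` in each direction, so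
-- their difference has ℓ¹ norm at most n times `hi`.
rectangle-diameter : ∀ {lo hi A} → IsRectangle {n} lo hi A →
  ∀ {x y} → x ∈ A → y ∈ A → ρ≤ (ι (+ n) * hi) x y
rectangle-diameter {hi = hi} (z , a , b , (A⊆box , _) , sides) {x} {y} x∈A y∈A
  with A⊆box x∈A | A⊆box y∈A
... | g , g∈Q , gz≈x | h , h∈Q , hz≈y =
  ‖ h ⊕ ⊝ g ‖ , walkAlong (h ⊕ ⊝ g) hgx≈y , ‖‖-bound (h ⊕ ⊝ g) coordinate
  where
  hgx≈y : (h ⊕ ⊝ g) · x ≈ y
  hgx≈y k = trans (sym (·-assoc h (⊝ g) x k))
    (trans (sym (gz≈x (⊝ g ⊕ (h ⊕ k)))) (trans (⊝·-inverse g z (h ⊕ k)) (hz≈y k)))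

  coordinate : ∀ i → ι (+ ℤ.∣ lookup (h ⊕ ⊝ g) i ∣) ℚ.≤ hi
  coordinate i
    rewrite Vec.lookup-zipWith ℤ._+_ i h (⊝ g) | Vec.lookup-map i ℤ.-_ g =
    ℚ.≤-trans (ι-mono (interval-diameter (h∈Q i) (g∈Q i))) (proj₂ (sides i))

rectangle-side≥1 : ∀ {lo hi A} → Fin n → IsRectangle {n} lo hi A → 0ℚ < lo → ι 1ℤ ℚ.≤ hi
rectangle-side≥1 i (_ , a , b , _ , sides) 0<lo = ℚ.≤-trans
  (ι-pos⇒1≤ {lookup b i ℤ.- lookup a i} (ℚ.<-≤-trans 0<lo (proj₁ (sides i))))
  (proj₂ (sides i))

-- Decidable search in balls.

anySign? : ∀ {A : Pred Sign 0ℓ} → Decidable A → Dec (∃[ σ ] σ ∈ A)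
anySign? A? = map′
  (λ where (inj₁ a) → Sign.+ , a
           (inj₂ a) → Sign.- , a)
  (λ where (Sign.+ , a) → inj₁ a
           (Sign.- , a) → inj₂ a)
  (A? Sign.+ ⊎-dec A? Sign.-)

module _ {A : Pred (FreePart n) 0ℓ} (A? : Decidable A)
         (A-resp : ∀ {x y} → x ≈ y → x ∈ A → y ∈ A) where

  -- Finitely many sequences of generators have length `L`. Walks end only up to `≈`, whence
  -- `A-resp`.
  walkTo? : ∀ L x → Dec (∃[ y ] (Walk U L x y × y ∈ A))
  walkTo? zero x = map′
    (λ x∈A → x , stop tt (λ _ → refl) , x∈A)
    (λ where (y , stop _ x≈y , y∈A) → A-resp {y} {x} (λ k → sym (x≈y k)) y∈A)
    (A? x)
  walkTo? (suc L) x = map′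
    (λ (σ , i , y , w , y∈A) → y , move tt σ i w , y∈A)
    (λ where (y , move _ σ i w , y∈A) → σ , i , y , w , y∈A)
    (anySign? λ σ → Fin.any? λ i → walkTo? L (gen σ i · x))

  within? : ∀ q x → Dec (∃[ y ] (ρ≤ q x y × y ∈ A))
  within? q x = map′
    (λ (L , _ , L≤q , y , w , y∈A) → y , (L , w , L≤q) , y∈A)
    (λ (y , (L , w , L≤q) , y∈A) → L , ℕ.s≤s (ι≤⇒≤∣↥∣ L≤q) , L≤q , y , w , y∈A)
    (ℕ.anyUpTo? (λ L → ι (+ L) ℚ.≤? q ×-dec walkTo? L x) (suc ℤ.∣ ℚ.↥ q ∣))

-- Boundary points of clopen partitions.

module _ (P : ClopenPartition n) where
  open ClopenPartition P
  open IsEquivalence isEquivalence using ()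
    renaming (refl to ∼-refl; sym to ∼-sym; trans to ∼-trans)

  -- Only the region of `x` itself is consulted, which makes this decidable by clopenness. The sign
  -- is quantified away because faces with opposite normals also count as parallel.
  Splits : Fin n → Pred (FreePart n) 0ℓ
  Splits i x = ∃[ σ ] gen σ i · x ∉ region P x

  splits? : ∀ i → Decidable (Splits i)
  splits? i x = anySign? λ σ → ¬? (proj₁ (clopen (gen σ i)) x)

  splits-resp : ∀ {i x y} → x ≈ y → Splits i x → Splits i y
  splits-resp {i} {x} {y} x≈y (σ , x≁) = σ , λ y∼ → x≁
    (∼-trans (reflexive {x} {y} x≈y) (∼-trans y∼
      (reflexive {gen σ i · y} {gen σ i · x} λ k → sym (x≈y (gen σ i ⊕ k)))))

  splits⇒∂ : ∀ {i x} → Splits i x → x ∈ ∂ (region P x)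
  splits⇒∂ (σ , x≁) = ∼-refl , σ , _ , x≁

  ∂⇒splits : ∀ {x y} → x ∈ ∂ (region P y) → ∃[ i ] Splits i x
  ∂⇒splits (y∼x , σ , i , y≁) = i , σ , λ x∼ → y≁ (∼-trans y∼x x∼)

  splits⇒face : ∀ {i x} (x∈ : Splits i x) → ∀ {y} → x ≈ y → y ∈ face (region P x) (proj₁ x∈) i x
  splits⇒face (σ , x≁) x≈y = 0 , stop (∼-refl , x≁) x≈y

  ¬splits⇒∼ : ∀ {x} → ¬ (∃[ i ] Splits i x) → ∀ σ i → x ∼ gen σ i · x
  ¬splits⇒∼ {x} ¬s σ i = decidable-stable (proj₁ (clopen (gen σ i)) x) λ x≁ → ¬s (i , σ , x≁)

  -- Follow the walk until an edge first leaves the region of `x`; the initial point of that edge is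
  -- `z`.
  crossing : ∀ {q x y} → ρ≤ q x y → ¬ x ∼ y → ∃[ z ] (ρ≤ q x z × ∃[ i ] Splits i z)
  crossing (L , w , L≤q) x≁y with go w x≁y
    where
    go : ∀ {L x y} → Walk U L x y → ¬ x ∼ y →
      ∃[ M ] (M ℕ.≤ L × ∃[ z ] (Walk U M x z × ∃[ i ] Splits i z))
    go {x = x} {y} (stop _ x≈y) x≁y = contradiction (reflexive {x} {y} x≈y) x≁y
    go {x = x} (move _ σ i w) x≁y with proj₁ (clopen (gen σ i)) x
    ... | no  x≁ = 0 , ℕ.z≤n , x , stop tt (λ _ → refl) , i , σ , x≁
    ... | yes x∼ with go w (λ gx∼y → x≁y (∼-trans x∼ gx∼y))
    ...   | M , M≤L , z , v , s = suc M , ℕ.s≤s M≤L , z , move tt σ i v , s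
  ... | M , M≤L , z , v , s = z , (M , v , ℚ.≤-trans (ι-mono (ℤ.+≤+ M≤L)) L≤q) , s

-- One step of the layering.

refines-last : ∀ {m} (P : Fin (suc m) → ClopenPartition n) →
  (∀ j → P (inject₁ j) Refines P (suc j)) → P zero Refines P (fromℕ m)
refines-last {m = zero}  P refines x = id
refines-last {m = suc m} P refines x = refines-last (P ∘ suc) (refines ∘ suc) x ∘ refines zero x

-- The rectangles of `x` and of its neighbour meet their assigned regions of `R⁺` at `u` and `v`. On
-- the route from `u` through `x` and its neighbour to `v`, of length at most r + 1 + r, a region of
-- `R⁺` is left. The direction may change from `i` to `i′`, so δ has to be chosen anew at each
-- level.
ascend : ∀ {C : Constants n} {dₖ d′ₖ R R̃ m k} → Layering C dₖ d′ₖ R R̃ m k →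
  ∀ {i x} → Splits (R m k) i x → let r = ι (+ n) * d′ₖ in
  ∃[ z ] (ρ≤ (r ℚ.+ (r ℚ.+ (ι 1ℤ ℚ.+ r))) x z × ∃[ i′ ] Splits (R m (suc k)) i′ z)
ascend {n} {d′ₖ = d′ₖ} {R} {m = m} {k} layering {i} {x} (σ , x≁gx) =
  let u , x∼u , ax   = meets x
      v , gx∼v , agx = meets (gen σ i · x)
      xu             = base-diameter x∼u
      gxv            = base-diameter gx∼v
      z , uz , s     = crossing R⁺
        (ρ≤-trans (ρ≤-sym xu) (ρ≤-trans (ρ≤-gen σ i x) gxv)) (assigned-apart ax agx)
  in z , ρ≤-trans xu uz , s
  where
  open Layering layering
  open Assignment assignment using (meets; respects)

  -- A rectangle of `layer zero` inherits its diameter bound from the rectangle of `base` around it.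
  -- As d′ₖ will be dₖ/ε₀, this puts the factor `ε₀⁻¹` into `drift`.
  base-diameter : ∀ {x y} → y ∈ region (layer zero) x → ρ≤ (ι (+ n) * d′ₖ) x y
  base-diameter {x} x∼y = rectangle-diameter (base-rectangles x)
    (IsEquivalence.refl (ClopenPartition.isEquivalence base))
    (refines-last layer (Subdivides.refines ∘ subdivides) x x∼y)

  -- A common assigned region would put `x` and its neighbour into one region of `R m k`.
  assigned-apart : ∀ {u v} → Assigned x u → Assigned (gen σ i · x) v → v ∉ region R⁺ u
  assigned-apart {u} ax agx u∼v = x≁gx (Equivalence.from (regions x (gen σ i · x)) (u , ax ,
    respects (IsEquivalence.refl (ClopenPartition.isEquivalence (layer zero)))
      (IsEquivalence.sym (ClopenPartition.isEquivalence R⁺) u∼v) agx))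

-- The constants.

module Scale (C : Constants n) where
  open Constants C
  open +-*-Solver

  instance
    ε₀≢0 : ℚ.NonZero (ε zero)
    ε₀≢0 = ℚ.pos⇒nonZero (ε zero) {{ℚ.positive ε₀-pos}}

  -- Two points within τ d_ℓ of faces, themselves τ d_ℓ apart, put these faces
  -- within 3τ d_ℓ; this must make them nearby (ν) but too close (ε⋆).
  τ : ℚ
  τ = (+ 1 / 4) * (ν ℚ.⊓ ε⋆)

  τ-pos : 0ℚ < τ
  τ-pos with ℚ.⊓-sel ν ε⋆
  ... | inj₁ eq rewrite eq = ℚ.positive⁻¹ _ {{ℚ.pos*pos⇒pos (+ 1 / 4) ν {{ℚ.positive ν-pos}}}}
  ... | inj₂ eq rewrite eq = ℚ.positive⁻¹ _ {{ℚ.pos*pos⇒pos (+ 1 / 4) ε⋆ {{ℚ.positive ε⋆-pos}}}}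

  instance
    τ≢0 : ℚ.NonZero τ
    τ≢0 = ℚ.pos⇒nonZero τ {{ℚ.positive τ-pos}}

  3τ : ℚ
  3τ = τ ℚ.+ (τ ℚ.+ τ)

  -- As 4τ is `ν ⊓ ε⋆`, the slack is τ. Strictness against `ε⋆` is what later yields the
  -- contradiction.
  3τ<min : 3τ < ν ℚ.⊓ ε⋆
  3τ<min = subst₂ _<_ (ℚ.+-identityˡ 3τ)
    (solve 1 (λ a → let t = con (+ 1 / 4) :* a in t :+ (t :+ (t :+ t)) := a) refl (ν ℚ.⊓ ε⋆))
    (ℚ.+-monoˡ-< 3τ τ-pos)

  3τ≤ν : 3τ ℚ.≤ ν
  3τ≤ν = ℚ.≤-trans (ℚ.<⇒≤ 3τ<min) (ℚ.p⊓q≤p ν ε⋆)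

  3τ<ε⋆ : 3τ < ε⋆
  3τ<ε⋆ = ℚ.<-≤-trans 3τ<min (ℚ.p⊓q≤q ν ε⋆)

  -- K is chosen so that an error τ d_k, increased by the drift of one step of
  -- the layering, is at most τ d_{k+1}.
  ε₀⁻¹ drift K : ℚ
  ε₀⁻¹ = ℚ.1/ ε zero
  drift = (+ 3 / 1) * (ι (+ n) * ε₀⁻¹) ℚ.+ ι 1ℤ
  K = ℚ.1ℚ ℚ.+ drift * ℚ.1/ τ

  τ-growth : ∀ q → τ * q ℚ.+ drift * q ≡ τ * (K * q)
  τ-growth q = begin
    τ * q ℚ.+ drift * q                  ≡⟨ cong (λ a → τ * q ℚ.+ a * q) (ℚ.*-identityʳ drift) ⟨
    τ * q ℚ.+ drift * ℚ.1ℚ * q           ≡⟨ cong (λ a → τ * q ℚ.+ drift * a * q) (ℚ.*-inverseˡ τ) ⟨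
    τ * q ℚ.+ drift * (ℚ.1/ τ * τ) * q   ≡⟨ solve 4 (λ t c u q →
      t :* q :+ c :* (u :* t) :* q := t :* ((con ℚ.1ℚ :+ c :* u) :* q)) refl τ drift (ℚ.1/ τ) q ⟩
    τ * (K * q)                          ∎
    where open ≡-Reasoning

  -- The three diameters amount to 3n/ε₀ times `q`, and the single edge between `x` and its
  -- neighbour is absorbed by `1 ≤ q`.
  drift-bound : ∀ {q q′} → q ≡ ε zero * q′ → ι 1ℤ ℚ.≤ q → let r = ι (+ n) * q′ in
    r ℚ.+ (r ℚ.+ (ι 1ℤ ℚ.+ r)) ℚ.≤ drift * q
  drift-bound {q′ = q′} refl 1≤q = begin
    N * q′ ℚ.+ (N * q′ ℚ.+ (ι 1ℤ ℚ.+ N * q′))       ≡⟨ solve 2 (λ N q →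
      N :* q :+ (N :* q :+ (con (ι 1ℤ) :+ N :* q)) :=
      con (+ 3 / 1) :* N :* q :+ con (ι 1ℤ)) refl N q′ ⟩
    (+ 3 / 1) * N * q′ ℚ.+ ι 1ℤ                     ≤⟨ ℚ.+-monoʳ-≤ ((+ 3 / 1) * N * q′) 1≤q ⟩
    (+ 3 / 1) * N * q′ ℚ.+ e * q′                   ≡⟨
      cong (λ a → (+ 3 / 1) * N * a ℚ.+ e * q′) (ℚ.*-identityˡ q′) ⟨
    (+ 3 / 1) * N * (ℚ.1ℚ * q′) ℚ.+ e * q′          ≡⟨
      cong (λ a → (+ 3 / 1) * N * (a * q′) ℚ.+ e * q′) (ℚ.*-inverseˡ e) ⟨
    (+ 3 / 1) * N * (ε₀⁻¹ * e * q′) ℚ.+ e * q′      ≡⟨ solve 4 (λ N e f q →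
      con (+ 3 / 1) :* N :* (f :* e :* q) :+ e :* q :=
      (con (+ 3 / 1) :* (N :* f) :+ con (ι 1ℤ)) :* (e :* q)) refl N e ε₀⁻¹ q′ ⟩
    drift * (e * q′)                                ∎
    where
    open ℚ.≤-Reasoning
    N = ι (+ n)
    e = ε zero

-- The least element of a decidable subset of `Fin m`.

module _ {A : Set} where

  -- With values in a fixed `A`, the recursion can pass to the tail by composing `f` with `suc`
  -- while the default stays the same.
  firstOr : ∀ {m} {Q : Pred (Fin m) 0ℓ} → A → (Fin m → A) → Decidable Q → A
  firstOr {zero}  a f Q? = a
  firstOr {suc m} a f Q? =
    if does (Q? zero) then f zero else firstOr a (f ∘ suc) (Q? ∘ suc)

  firstOr-⇔ : ∀ {m} {Q Q′ : Pred (Fin m) 0ℓ} a f (Q? : Decidable Q) (Q′? : Decidable Q′) →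
    (∀ i → Q i ⇔ Q′ i) → firstOr a f Q? ≡ firstOr a f Q′?
  firstOr-⇔ {zero}  a f Q? Q′? Q⇔Q′ = refl
  firstOr-⇔ {suc m} a f Q? Q′? Q⇔Q′ = cong₂ (λ b c → if b then f zero else c)
    (does-⇔ (Q⇔Q′ zero) (Q? zero) (Q′? zero))
    (firstOr-⇔ a (f ∘ suc) (Q? ∘ suc) (Q′? ∘ suc) (Q⇔Q′ ∘ suc))

  firstOr-none : ∀ {m} {Q : Pred (Fin m) 0ℓ} a f (Q? : Decidable Q) →
    (∀ i → ¬ Q i) → firstOr a f Q? ≡ a
  firstOr-none {zero}  a f Q? ¬Q = refl
  firstOr-none {suc m} a f Q? ¬Q with Q? zero
  ... | yes q = contradiction q (¬Q zero)
  ... | no  _ = firstOr-none a (f ∘ suc) (Q? ∘ suc) (¬Q ∘ suc)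

  firstOr-some : ∀ {m} {Q : Pred (Fin m) 0ℓ} a f (Q? : Decidable Q) →
    ∀ {i} → Q i → ∃[ j ] (Q j × firstOr a f Q? ≡ f j)
  firstOr-some {suc m} a f Q? {i} q with Q? zero
  ... | yes q₀ = zero , q₀ , refl
  firstOr-some {suc m} a f Q? {zero}  q | no ¬q₀ = contradiction q ¬q₀
  firstOr-some {suc m} a f Q? {suc i} q | no _ =
    let j , qⱼ , eq = firstOr-some a (f ∘ suc) (Q? ∘ suc) q in suc j , qⱼ , eq

-- Approach to faces at every level.

module Markers
  (C : Constants (suc n)) (d : ℕ → ℚ) (d₁-pos : 0ℚ < d 1)
  (d-mono : ∀ k → 1 ℕ.≤ k → d k < d (suc k))
  (d-growth : ∀ k → 1 ℕ.≤ k → Scale.K C * d k < d (suc k))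
  (R : Family (suc n)) (markers : LayeredMarkers C d R) where

  open Constants C
  open Scale C
  open LayeredMarkers markers
  open Orthogonal orthogonal

  d₁≤d : ∀ k → d 1 ℚ.≤ d (suc k)
  d₁≤d zero    = ℚ.≤-refl
  d₁≤d (suc k) = ℚ.≤-trans (d₁≤d k) (ℚ.<⇒≤ (d-mono (suc k) (ℕ.s≤s ℕ.z≤n)))

  d-pos : ∀ k → 0ℚ < d (suc k)
  d-pos k = ℚ.<-≤-trans d₁-pos (d₁≤d k)

  τd-pos : ∀ k → 0ℚ < τ * d (suc k)
  τd-pos k = ℚ.positive⁻¹ _
    {{ℚ.pos*pos⇒pos τ {{ℚ.positive τ-pos}} (d (suc k)) {{ℚ.positive (d-pos k)}}}}

  -- Side lengths are integers, and those of `R 1 1` lie between the positive number `½ * d 1` and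
  -- `d 1`. The point `x` supplies a rectangle to measure.
  1≤d : FreePart (suc n) → ∀ k → ι 1ℤ ℚ.≤ d (suc k)
  1≤d x k = ℚ.≤-trans
    (rectangle-side≥1 zero (top ℕ.≤-refl x)
      (ℚ.positive⁻¹ _ {{ℚ.pos*pos⇒pos ℚ.½ (d 1) {{ℚ.positive d₁-pos}}}}))
    (d₁≤d k)

  Approaches : ℕ → ℕ → FreePart (suc n) → Pred (Fin (suc n)) 0ℓ
  Approaches m ℓ x i = ∃[ z ] (ρ≤ (τ * d ℓ) x z × Splits (R m ℓ) i z)

  -- Induction on the level: the error is 0 at level 1, and each use of `ascend` adds at most
  -- `drift * d`, which the growth of `d` by the factor `K` absorbs.
  approaches : ∀ {m i x} → Splits (R m 1) i x → ∀ ℓ → suc ℓ ℕ.≤ m →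
    ∃[ i′ ] Approaches m (suc ℓ) x i′
  approaches {i = i} {x} s zero _ = i , x , ρ≤-refl x (ℚ.<⇒≤ (τd-pos 0)) , s
  approaches {m} {x = x} s (suc ℓ) ℓ<m =
    let _ , y , xy , s′  = approaches {m} s ℓ (ℕ.<⇒≤ ℓ<m)
        z , yz , i′ , s″ = ascend (layering (ℕ.s≤s ℕ.z≤n) ℓ<m) s′
    in i′ , z , ρ≤-mono small (ρ≤-trans xy yz) , s″
    where
    open ℚ.≤-Reasoning
    r = ι (+ suc n) * d′ (suc ℓ)
    small : τ * d (suc ℓ) ℚ.+ (r ℚ.+ (r ℚ.+ (ι 1ℤ ℚ.+ r))) ℚ.≤ τ * d (suc (suc ℓ))
    small = begin
      τ * d (suc ℓ) ℚ.+ (r ℚ.+ (r ℚ.+ (ι 1ℤ ℚ.+ r)))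
        ≤⟨ ℚ.+-monoʳ-≤ (τ * d (suc ℓ)) (drift-bound (d≡ε₀d′ (ℕ.s≤s ℕ.z≤n)) (1≤d x ℓ)) ⟩
      τ * d (suc ℓ) ℚ.+ drift * d (suc ℓ)
        ≡⟨ τ-growth (d (suc ℓ)) ⟩
      τ * (K * d (suc ℓ))
        ≤⟨ ℚ.*-monoˡ-≤-nonNeg τ {{ℚ.pos⇒nonNeg τ {{ℚ.positive τ-pos}}}}
             (ℚ.<⇒≤ (d-growth (suc ℓ) (ℕ.s≤s ℕ.z≤n))) ⟩
      τ * d (suc (suc ℓ))
        ∎

  -- Otherwise the route from `z′` through `x′` and `x` to `z` has length at most 3τ times `D`, so
  -- the two faces perpendicular to the `i`-th direction are nearby and yet too close.
  approaches-separated : ∀ {k k′ ℓ i x x′} → k ℕ.< k′ → suc ℓ ℕ.≤ k →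
    Approaches k (suc ℓ) x i → Approaches k′ (suc ℓ) x′ i → ρ> (τ * d (suc ℓ)) x x′
  approaches-separated {k} {k′} {ℓ} {i} k<k′ ℓ≤k (z , xz , s) (z′ , x′z′ , s′) L w
    with τ * d (suc ℓ) ℚ.<? ι (+ L)
  ... | yes τd<L = τd<L
  ... | no  τd≮L = contradiction (ℚ.<-≤-trans close far) (ℚ.<-irrefl refl)
    where
    D = d (suc ℓ)
    τD = τ * D
    3τD≡ : τD ℚ.+ (τD ℚ.+ τD) ≡ 3τ * D
    3τD≡ = solve 2 (λ t q → t :* q :+ (t :* q :+ t :* q) := (t :+ (t :+ t)) :* q) refl τ D
      where open +-*-Solver
    z′z : ρ≤ (τD ℚ.+ (τD ℚ.+ τD)) z′ z
    z′z = ρ≤-trans (ρ≤-sym x′z′) (ρ≤-trans (ρ≤-sym (L , w , ℚ.≮⇒≥ τd≮L)) xz)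
    -- The displacement along this route witnesses the perpendicular distance of the faces by its
    -- `i`-th coordinate.
    jump = displacement (proj₁ (proj₂ z′z))
    g = proj₁ jump
    face′ = splits⇒face (R k′ (suc ℓ)) s′ {z′} λ _ → refl
    close : ι (+ ℤ.∣ lookup g i ∣) < ε⋆ * D
    close = ℚ.≤-<-trans
      (ℚ.≤-trans (ι-mono (ℤ.+≤+ (proj₂ (proj₂ jump) i)))
        (ℚ.≤-trans (proj₂ (proj₂ z′z)) (ℚ.≤-reflexive 3τD≡)))
      (ℚ.*-monoˡ-<-pos D {{ℚ.positive (d-pos ℓ)}} 3τ<ε⋆)
    far : ε⋆ * D ℚ.≤ ι (+ ℤ.∣ lookup g i ∣)
    -- The later partition `k′` comes first: `apart` compares it with an earlier one at the common
    -- level `suc ℓ`.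
    far = apart (ℕ.s≤s ℕ.z≤n) ℓ≤k k<k′ z′ z i (proj₁ s′) (proj₁ s) z′ z
      (z′ , z , face′ , splits⇒face (R k (suc ℓ)) s (λ _ → refl) ,
        ρ≤-mono (ℚ.≤-trans (ℚ.≤-reflexive 3τD≡)
          (ℚ.*-monoʳ-≤-nonNeg D {{ℚ.pos⇒nonNeg D {{ℚ.positive (d-pos ℓ)}}}} 3τ≤ν)) z′z)
      (z′ , g , face′ ,
        splits⇒face (R k (suc ℓ)) s {g · z′} (λ h → sym (proj₁ (proj₂ jump) h)) , refl)

  -- The function δ.

  X⇒splits : ∀ {k x} → x ∈ X R k → ∃[ i ] Splits (R k 1) i x
  X⇒splits {k} {x} (y , x∈∂) = ∂⇒splits (R k 1) {x} {y} x∈∂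

  -- The first two conditions make δ take its default `zero` where it has to vanish. They ask for
  -- membership in X_k, which is decidable in this form, and not in the infinite union.
  Colour : ℕ → ℕ → FreePart (suc n) → Pred (Fin (suc n)) 0ℓ
  Colour k ℓ x i = (∃[ j ] Splits (R k 1) j x) × ℓ ℕ.≤ k × Approaches k ℓ x i

  colour? : ∀ k ℓ x → Decidable (Colour k ℓ x)
  colour? k ℓ x i = Fin.any? (λ j → splits? (R k 1) j x) ×-dec ℓ ℕ.≤? k ×-dec
    within? (splits? (R k ℓ) i) (splits-resp (R k ℓ)) (τ * d ℓ) x

  colour-resp : ∀ {k ℓ x y i} → x ≈ y → Colour k ℓ x i → Colour k ℓ y i
  colour-resp {k} {ℓ} {x} {y} x≈y ((j , s) , ℓ≤k , z , (L , w , L≤) , s′) =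
    (j , splits-resp (R k 1) {j} {x} {y} x≈y s) , ℓ≤k , z ,
    (L , walk-respˡ {x = x} {y} x≈y w , L≤) , s′

  δ : FreePart (suc n) → ℕ → ℕ → Fin (suc n)
  δ x k ℓ = firstOr zero id (colour? k ℓ x)

  δ-resp : ∀ {x y} → x ≈ y → ∀ k ℓ → δ x k ℓ ≡ δ y k ℓ
  δ-resp {x} {y} x≈y k ℓ = firstOr-⇔ zero id (colour? k ℓ x) (colour? k ℓ y) λ i →
    mk⇔ (colour-resp {x = x} {y} x≈y) (colour-resp {x = y} {x} λ h → sym (x≈y h))

  δ-trivial : ∀ x k ℓ → ¬ (x ∈ X∞ R k × ℓ ℕ.≤ k) → toℕ (δ x k ℓ) ≡ 0
  δ-trivial x k ℓ ¬x = cong toℕ (firstOr-none zero id (colour? k ℓ x)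
    λ i ((_ , s) , ℓ≤k , _) →
      ¬x ((k , ℕ.≤-refl , x , splits⇒∂ (R k 1) s) , ℓ≤k))

  δ-approaches : ∀ {k x} → x ∈ X R k → ∀ {ℓ} → suc ℓ ℕ.≤ k →
    Approaches k (suc ℓ) x (δ x k (suc ℓ))
  δ-approaches {k} {x} x∈X {ℓ} ℓ<k =
    let j , s = X⇒splits {k} x∈X
        i , a = approaches {k} s ℓ ℓ<k
        _ , (_ , _ , b) , eq = firstOr-some zero id (colour? k (suc ℓ) x) {i} ((j , s) , ℓ<k , a)
    in subst (Approaches k (suc ℓ) x) (sym eq) b

  δ-separated : ∀ {k k′ x x′} → k ℕ.< k′ → x ∈ X R k → x′ ∈ X R k′ →
    ∀ {ℓ} → 1 ℕ.≤ ℓ → ℓ ℕ.≤ k → δ x k ℓ ≡ δ x′ k′ ℓ → ρ> (τ * d ℓ) x x′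
  δ-separated {k} {k′} {x} {x′} k<k′ x∈ x′∈ {suc ℓ} _ ℓ≤k eq =
    approaches-separated {k} {k′} {x = x} {x′} k<k′ ℓ≤k (δ-approaches x∈ ℓ≤k)
      (subst (Approaches k′ (suc ℓ) x′) (sym eq)
        (δ-approaches x′∈ (ℕ.≤-trans ℓ≤k (ℕ.<⇒≤ k<k′))))

  -- The empty intersection.

  X∞-vanishes : Empty (⋂ ℕ (λ k → X∞ R (suc k)))
  X∞-vanishes x x∈ =
    -- In dimension n + 1, two of n + 2 levels share a direction at ℓ = 1. The point would then be
    -- at positive distance from itself.
    let i , j , i<j , eq = Fin.pigeonhole (ℕ.n<1+n (suc n)) (λ i → δ x (level (toℕ i)) 1)
    in ℚ.<-asym (τd-pos 0)
         (δ-separated {level (toℕ i)} {level (toℕ j)} {x} {x} (level-mono i<j)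
           (level-∈ (toℕ i)) (level-∈ (toℕ j)) {1}
           ℕ.≤-refl (level≥1 (toℕ i)) eq 0 (stop tt λ _ → refl))
    where
    level : ℕ → ℕ
    -- Membership in `X∞ R (suc k)` provides an index above `k`, so iterating gives strictly
    -- increasing levels, all at least 1.
    level zero    = proj₁ (x∈ 0)
    level (suc j) = proj₁ (x∈ (level j))

    level-step : ∀ j → level j ℕ.< level (suc j)
    level-step j = proj₁ (proj₂ (x∈ (level j)))

    level-∈ : ∀ j → x ∈ X R (level j)
    level-∈ zero    = proj₂ (proj₂ (x∈ 0))
    level-∈ (suc j) = proj₂ (proj₂ (x∈ (level j)))

    level≥1 : ∀ j → 1 ℕ.≤ level j
    level≥1 zero    = proj₁ (proj₂ (x∈ 0))
    level≥1 (suc j) = ℕ.≤-trans (ℕ.s≤s ℕ.z≤n) (level-step j)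

    level-mono : ∀ {i j} → i ℕ.< j → level i ℕ.< level j
    level-mono {i} {suc j} (ℕ.s≤s i≤j) with ℕ.m≤n⇒m<n∨m≡n i≤j
    ... | inj₁ i<j  = ℕ.<-trans (level-mono i<j) (level-step j)
    ... | inj₂ refl = level-step i

-- Finiteness of components.

component⊆region : ∀ (R : Family n) k x →
  Component (∁ (X∞ R k)) x ⊆ region (R k 1) x
component⊆region R k x (_ , w) = go w
  where
  open ClopenPartition (R k 1)
  go : ∀ {L x y} → Walk (∁ (X∞ R k)) L x y → x ∼ y
  go {x = x} {y} (stop _ x≈y) = reflexive {x} {y} x≈y
  go {x = x} (move x∉ σ i w) = IsEquivalence.trans isEquivalence
    -- Avoiding the union includes avoiding its term of index `k`, so no edge at `x` leaves the
    -- region.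
    (¬splits⇒∼ (R k 1) (λ (_ , s) → x∉ (k , ℕ.≤-refl , x , splits⇒∂ (R k 1) s)) σ i)
    (go w)

theorem3p1 : (n : ℕ) .{{_ : NonZero n}} (C : Constants n) →
    ∃[ K ] ∃[ ε ] (0ℚ < ε × (
    (d : ℕ → ℚ) → 0ℚ < d 1 →
    (∀ k → 1 ℕ.≤ k → d k < d (suc k)) →
    (∀ k → 1 ℕ.≤ k → K * d k < d (suc k)) →
    (R : Family n) → LayeredMarkers C d R →
    (Empty (⋂ ℕ (λ k → X∞ R (suc k))) ×
    (∀ k → 1 ℕ.≤ k → ∀ x → x ∈ ∁ (X∞ R k) → Finite (Component (∁ (X∞ R k)) x)))
    ×
    (Σ[ δ ∈ (FreePart n → ℕ → ℕ → Fin n) ] (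
    (∀ {x y} → x ≈ y → ∀ k ℓ → δ x k ℓ ≡ δ y k ℓ) ×
    (∀ x k ℓ → 1 ℕ.≤ k → ¬ (x ∈ X∞ R k × ℓ ℕ.≤ k) → toℕ (δ x k ℓ) ≡ 0) ×
    (∀ {k k′ x x′} → k ℕ.< k′ → x ∈ X R k → x′ ∈ X R k′ →
    ∀ {ℓ} → 1 ℕ.≤ ℓ → ℓ ℕ.≤ k → δ x k ℓ ≡ δ x′ k′ ℓ →
    ρ> (ε * d ℓ) x x′)))))
-- `NonZero` leaves only successors, so that `Fin` has the default value `zero` for δ. Both `K` and
-- `τ` come from `C` alone.
theorem3p1 (suc n) C = K , τ , τ-pos , λ d d₁-pos d-mono d-growth R markers →
  let open Markers C d d₁-pos d-mono d-growth R markers in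
  (X∞-vanishes , λ k _ x _ →
    let L , covers = ClopenPartition.finite (R k 1) x
    in L , λ {y} y∈ → covers {y} (component⊆region R k x {y} y∈)) ,
  δ , (λ {x} {y} → δ-resp {x} {y}) , (λ x k ℓ _ → δ-trivial x k ℓ) , δ-separated
  where open Scale C
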